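{- Let $A$ be an integral residuated $\vee$-semilattice. Then: (1) $A$ is a $\to$-MTL-algebra if and only if the set of $\to$-prime filters of $A$ equals the set of $\vee$-prime filters of $A$; (2) $A$ is a $\leadsto$-MTL-algebra if and only if the set of $\leadsto$-prime filters of $A$ equals the set of $\vee$-prime filters of $A$; (3) $A$ is a pseudo MTL-algebra if and only if the set of prime filters of $A$ equals the set of $\vee$-prime filters of $A$.
   Context: A residuated poset is a partially ordered semigroup $(A;\cdot,\le)$ with binary operations $\to,\leadsto$ such that $x\cdot y\le z$ iff $x\le y\to z$ iff $y\le x\leadsto z$ for all $x,y,z$. It is a residuated $\vee$-semilattice if $(A,\le)$ is a join-semilattice (every pair has a supremum $x\vee y$). It is integral if it has a greatest element $1$ which is a multiplicative identity ($1\cdot x=x\cdot 1=x$). A filter of $A$ is a nonempty subset $F$ that is upward closed and closed under $\cdot$. A filter $F$ is $\to$-prime if for all $x,y\in A$, $x\to y\in F$ or $y\to x\in F$; $\leadsto$-prime if for all $x,y$, $x\leadsto y\in F$ or $y\leadsto x\in F$; prime if it is both $\to$-prime and $\leadsto$-prime; $\vee$-prime if $x\vee y\in F$ implies $x\in F$ or $y\in F$. $A$ is a $\to$-MTL-algebra if $(x\to y)\vee(y\to x)=1$ for all $x,y$; a $\leadsto$-MTL-algebra if $(x\leadsto y)\vee(y\leadsto x)=1$ for all $x,y$; a pseudo MTL-algebra if it is both. -}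

module Defs where

open import Algebra.Core using (Op₂)
open import Algebra.Definitions using (Identity)
open import Algebra.Structures using (IsSemigroup)
open import Data.Product using (_×_; ∃)
open import Data.Sum using (_⊎_)
open import Function.Bundles using (_⇔_)
open import Level using (Level; suc; _⊔_)
open import Relation.Binary.Bundles using (Poset)
open import Relation.Binary.Core using (Rel; _Preserves₂_⟶_⟶_)
open import Relation.Binary.Definitions using (Maximum)
open import Relation.Binary.Lattice.Structures using (IsJoinSemilattice)
open import Relation.Binary.Structures using (IsPartialOrder)
open import Relation.Unary using (Pred; _∈_; _∩_)

record IsResiduatedPoset {a ℓ₁ ℓ₂} {A : Set a} (_≈_ : Rel A ℓ₁) (_≤_ : Rel A ℓ₂)
                         (_∙_ _⇨_ _⇝_ : Op₂ A) : Set (a ⊔ ℓ₁ ⊔ ℓ₂) where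
  field
    isPartialOrder : IsPartialOrder _≈_ _≤_
    isSemigroup    : IsSemigroup _≈_ _∙_
    ∙-mono         : _∙_ Preserves₂ _≤_ ⟶ _≤_ ⟶ _≤_
    ⇨-residual     : ∀ x y z → ((x ∙ y) ≤ z) ⇔ (x ≤ (y ⇨ z))
    ⇝-residual     : ∀ x y z → ((x ∙ y) ≤ z) ⇔ (y ≤ (x ⇝ z))

-- The residual → is written ⇨, since → is reserved.
record IntegralResiduatedJoinSemilattice c ℓ₁ ℓ₂ : Set (suc (c ⊔ ℓ₁ ⊔ ℓ₂)) where
  infix  4 _≈_ _≤_
  infixr 5 _⇨_ _⇝_
  infixr 6 _∨_
  infixl 7 _∙_
  field
    Carrier           : Set c
    _≈_               : Rel Carrier ℓ₁
    _≤_               : Rel Carrier ℓ₂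
    _∙_ _⇨_ _⇝_ _∨_   : Op₂ Carrier
    1#                : Carrier
    isResiduatedPoset : IsResiduatedPoset _≈_ _≤_ _∙_ _⇨_ _⇝_
    isJoinSemilattice : IsJoinSemilattice _≈_ _≤_ _∨_
    maximum           : Maximum _≤_ 1#
    identity          : Identity _≈_ 1# _∙_

module _ {c ℓ₁ ℓ₂} (A : IntegralResiduatedJoinSemilattice c ℓ₁ ℓ₂) where
  open IntegralResiduatedJoinSemilattice A

  Is⇨MTL : Set (c ⊔ ℓ₁)
  Is⇨MTL = ∀ x y → (x ⇨ y) ∨ (y ⇨ x) ≈ 1#

  Is⇝MTL : Set (c ⊔ ℓ₁)
  Is⇝MTL = ∀ x y → (x ⇝ y) ∨ (y ⇝ x) ≈ 1#

  IsPseudoMTL : Set (c ⊔ ℓ₁)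
  IsPseudoMTL = Is⇨MTL × Is⇝MTL

  -- The improper filter F = A is a filter.  Upward closure makes F respect _≈_.
  record IsFilter {p} (F : Pred Carrier p) : Set (c ⊔ ℓ₂ ⊔ p) where
    field
      nonempty     : ∃ λ x → x ∈ F
      upwardClosed : ∀ {x y} → x ≤ y → x ∈ F → y ∈ F
      ∙-closed     : ∀ {x y} → x ∈ F → y ∈ F → x ∙ y ∈ F

  -- For each kind of prime filter, the set of all such filters that are
  -- predicates of level p.
  module _ (p : Level) where

    ⇨PrimeFilters : Pred (Pred Carrier p) (c ⊔ ℓ₂ ⊔ p)
    ⇨PrimeFilters F = IsFilter F × (∀ x y → (x ⇨ y ∈ F) ⊎ (y ⇨ x ∈ F))

    ⇝PrimeFilters : Pred (Pred Carrier p) (c ⊔ ℓ₂ ⊔ p)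
    ⇝PrimeFilters F = IsFilter F × (∀ x y → (x ⇝ y ∈ F) ⊎ (y ⇝ x ∈ F))

    PrimeFilters : Pred (Pred Carrier p) (c ⊔ ℓ₂ ⊔ p)
    PrimeFilters = ⇨PrimeFilters ∩ ⇝PrimeFilters

    ∨PrimeFilters : Pred (Pred Carrier p) (c ⊔ ℓ₂ ⊔ p)
    ∨PrimeFilters F = IsFilter F × (∀ x y → x ∨ y ∈ F → (x ∈ F) ⊎ (y ∈ F))

-- Zorn's lemma, for chains that are predicates of level ℓ.  The empty chain is
-- not excluded, so the upper-bound hypothesis forces the poset to be nonempty.
-- The existence of enough ∨-prime filters needs a choice principle; like
-- excluded middle, it is not available in Agda and is passed as an assumption.
ZornsLemma : ∀ c ℓ₁ ℓ₂ ℓ → Set (suc (c ⊔ ℓ₁ ⊔ ℓ₂ ⊔ ℓ))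
ZornsLemma c ℓ₁ ℓ₂ ℓ = (P : Poset c ℓ₁ ℓ₂) → let open Poset P in
  (∀ (C : Pred Carrier ℓ) → (∀ {x y} → x ∈ C → y ∈ C → (x ≤ y) ⊎ (y ≤ x)) →
    ∃ λ u → ∀ {x} → x ∈ C → x ≤ u) →
  ∃ λ m → ∀ {x} → m ≤ x → x ≈ m

{-# OPTIONS --safe #-}

-- A →-prime or ⇝-prime filter is always ∨-prime, because (x → y) ∙ (x ∨ y) ≤ y
-- and (x ∨ y) ∙ (x ⇝ y) ≤ y; under prelinearity a ∨-prime filter is conversely
-- prime, since it contains 1 = (x → y) ∨ (y → x).  For the remaining
-- implications it suffices that every a ≠ 1 is avoided by some ∨-prime filter.
-- Zorn's lemma gives a filter F maximal among those avoiding a.  If x ∨ y ∈ F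
-- with x, y ∉ F, maximality gives f ∈ F and m, n with (f x)ᵐ ≤ a and
-- (f y)ⁿ ≤ a, whence (f (x ∨ y))ᵐ⁺ⁿ ≤ (f x)ᵐ ∨ (f y)ⁿ ≤ a, so a ∈ F.
module Submission where

open import Defs
open import Algebra.Bundles using (Monoid)
import Algebra.Properties.Monoid.Mult as Mult
open import Axiom.ExcludedMiddle using (ExcludedMiddle)
open import Data.Nat.Base using (ℕ; zero; suc; _+_)
open import Data.Nat.Properties using (+-suc)
open import Data.Product using (_×_; _,_; proj₁; proj₂; ∃; ∃₂; Σ; map₂)
open import Data.Sum using (_⊎_; inj₁; inj₂; [_,_])
open import Function.Base using (_∘_; id)
open import Function.Bundles using (_⇔_; mk⇔; Equivalence)
open import Level using (Level; Lift; lift; lower; 0ℓ; _⊔_) renaming (suc to lsuc)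
open import Relation.Binary.Bundles using (Poset)
open import Relation.Binary.Lattice.Structures using (IsJoinSemilattice)
open import Relation.Binary.PropositionalEquality using (subst; sym)
import Relation.Binary.Reasoning.PartialOrder as PosetReasoning
open import Relation.Binary.Structures using (IsPartialOrder)
open import Relation.Nullary using (¬_; contradiction)
open import Relation.Nullary.Decidable using (True; toWitness; fromWitness; yes; no; decidable-stable)
open import Relation.Unary using (Pred; _∈_; _∉_; _⊆_; _≐_)

-- Changing universe levels by excluded middle.

module Resizing (em : ∀ {ℓ} → ExcludedMiddle ℓ) where

  -- A decided proposition has a truth value in the lowest universe, which can be lifted to any
  -- level. This brings `Adjoin` and `⋃`, whose levels exceed `p` in general, down to filters of
  -- level `p`.
  Resize : ∀ p {ℓ} → Set ℓ → Set p
  Resize p P = Lift p (True (em {P = P}))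

  resize : ∀ {p ℓ} {P : Set ℓ} → P → Resize p P
  resize x = lift (fromWitness x)

  unresize : ∀ {p ℓ} {P : Set ℓ} → Resize p P → P
  unresize = toWitness ∘ lower

module Properties {c ℓ₁ ℓ₂} (A : IntegralResiduatedJoinSemilattice c ℓ₁ ℓ₂) where
  open IntegralResiduatedJoinSemilattice A
  open IsResiduatedPoset isResiduatedPoset
  open IsPartialOrder isPartialOrder
    using (antisym; module Eq) renaming (refl to ≤-refl; reflexive to ≤-reflexive; trans to ≤-trans)
  open IsJoinSemilattice isJoinSemilattice using (x≤x∨y; y≤x∨y; ∨-least)

  poset : Poset c ℓ₁ ℓ₂
  poset = record { isPartialOrder = isPartialOrder }

  monoid : Monoid c ℓ₁
  monoid = record { isMonoid = record { isSemigroup = isSemigroup ; identity = identity } }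

  open Mult monoid using (×-homo-+) renaming (_×_ to infixr 8 _×ᴹ_)

  infixr 8 _^_
  _^_ : Carrier → ℕ → Carrier
  x ^ n = n ×ᴹ x

  -- Inequalities from integrality and residuation.

  x∙y≤x : ∀ x y → x ∙ y ≤ x
  x∙y≤x x y = ≤-trans (∙-mono ≤-refl (maximum y)) (≤-reflexive (proj₂ identity x))

  x∙y≤y : ∀ x y → x ∙ y ≤ y
  x∙y≤y x y = ≤-trans (∙-mono (maximum x) ≤-refl) (≤-reflexive (proj₁ identity y))

  -- Left multiplication by `x` is left adjoint to `x ⇝_`, hence preserves joins.
  ∙-∨-least : ∀ {x y z w} → x ∙ y ≤ w → x ∙ z ≤ w → x ∙ (y ∨ z) ≤ w
  ∙-∨-least p q = from (∨-least (to p) (to q))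
    where open module R {x y z} = Equivalence (⇝-residual x y z)

  ∨-∙-least : ∀ {x y z w} → x ∙ z ≤ w → y ∙ z ≤ w → (x ∨ y) ∙ z ≤ w
  ∨-∙-least p q = from (∨-least (to p) (to q))
    where open module R {x y z} = Equivalence (⇨-residual x y z)

  ⇨-eval : ∀ x y → (x ⇨ y) ∙ x ≤ y
  ⇨-eval x y = Equivalence.from (⇨-residual _ _ _) ≤-refl

  ⇝-eval : ∀ x y → x ∙ (x ⇝ y) ≤ y
  ⇝-eval x y = Equivalence.from (⇝-residual _ _ _) ≤-refl

  ^-mono : ∀ n {x y} → x ≤ y → x ^ n ≤ y ^ n
  ^-mono zero    x≤y = ≤-refl
  ^-mono (suc n) x≤y = ∙-mono x≤y (^-mono n x≤y)

  -- Every word of length `m + n` in `x` and `y` has at least `m` letters `x` or at least `n`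
  -- letters `y`, and integrality deletes the rest. The induction splits off the first letter: `x`
  -- lowers `m`, `y` lowers `n`.
  [x∨y]^[m+n]≤x^m∨y^n : ∀ x y m n → (x ∨ y) ^ (m + n) ≤ x ^ m ∨ y ^ n
  [x∨y]^[m+n]≤x^m∨y^n x y zero    n       = ≤-trans (maximum _) (x≤x∨y _ _)
  [x∨y]^[m+n]≤x^m∨y^n x y (suc m) zero    = ≤-trans (maximum _) (y≤x∨y _ _)
  [x∨y]^[m+n]≤x^m∨y^n x y (suc m) (suc n) = ∨-∙-least
    (≤-trans (∙-mono ≤-refl ([x∨y]^[m+n]≤x^m∨y^n x y m (suc n)))
      (∙-∨-least (x≤x∨y _ _) (≤-trans (x∙y≤y _ _) (y≤x∨y _ _))))
    (≤-trans (∙-mono ≤-refl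
        (subst (λ k → (x ∨ y) ^ k ≤ x ^ suc m ∨ y ^ n) (sym (+-suc m n))
          ([x∨y]^[m+n]≤x^m∨y^n x y (suc m) n)))
      (∙-∨-least (≤-trans (x∙y≤y _ _) (x≤x∨y _ _)) (y≤x∨y _ _)))

  -- Filters and the adjunction of an element.

  module _ {p} {F : Pred Carrier p} (isFilter : IsFilter A F) where
    open IsFilter isFilter

    1∈ : 1# ∈ F
    1∈ = upwardClosed (maximum _) (proj₂ nonempty)

    ≈1⇒∈ : ∀ {x} → x ≈ 1# → x ∈ F
    ≈1⇒∈ x≈1 = upwardClosed (≤-reflexive (Eq.sym x≈1)) 1∈

    ^-closed : ∀ n {x} → x ∈ F → x ^ n ∈ F
    ^-closed zero    x∈F = 1∈
    ^-closed (suc n) x∈F = ∙-closed x∈F (^-closed n x∈F)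

    ∨-closed : ∀ {x y} → x ∈ F ⊎ y ∈ F → x ∨ y ∈ F
    ∨-closed = [ upwardClosed (x≤x∨y _ _) , upwardClosed (y≤x∨y _ _) ]

    -- The filter generated by F and x.
    Adjoin : Carrier → Pred Carrier (c ⊔ ℓ₂ ⊔ p)
    Adjoin x z = ∃₂ λ f n → f ∈ F × (f ∙ x) ^ n ≤ z

    -- For products, `f ∙ g` replaces both coefficients, being below each; both factors then bound
    -- powers of one element, whose exponents add.
    Adjoin-isFilter : ∀ x → IsFilter A (Adjoin x)
    Adjoin-isFilter x = record
      { nonempty     = 1# , 1# , 0 , 1∈ , ≤-refl
      ; upwardClosed = λ { y≤z (f , n , f∈F , le) → f , n , f∈F , ≤-trans le y≤z }
      ; ∙-closed     = λ { (f , m , f∈F , le) (g , n , g∈F , le′) →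
          f ∙ g , m + n , ∙-closed f∈F g∈F ,
          ≤-trans (≤-reflexive (×-homo-+ _ m n))
            (∙-mono (≤-trans (^-mono m (∙-mono (x∙y≤x f g) ≤-refl)) le)
                    (≤-trans (^-mono n (∙-mono (x∙y≤y f g) ≤-refl)) le′)) }
      }

    ⊆Adjoin : ∀ x → F ⊆ Adjoin x
    -- A first power unfolds to a product with a trailing `1#`; the first inequality drops it, the
    -- second drops `x`.
    ⊆Adjoin x {f} f∈F = f , 1 , f∈F , ≤-trans (x∙y≤x _ _) (x∙y≤x _ _)

    ∈Adjoin : ∀ x → x ∈ Adjoin x
    ∈Adjoin x = 1# , 1 , 1∈ , ≤-trans (x∙y≤x _ _) (x∙y≤y _ _)

    -- The two memberships come with different coefficients; their product `h` stays in `F` and lies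
    -- below both, so one power of `h ∙ (x ∨ y)` handles both.
    Adjoin-∨ : ∀ {x y z} → x ∨ y ∈ F → z ∈ Adjoin x → z ∈ Adjoin y → z ∈ F
    Adjoin-∨ {x} {y} {z} x∨y∈F (f , m , f∈F , le) (g , n , g∈F , le′) =
      upwardClosed
        (begin
          (h ∙ (x ∨ y)) ^ (m + n)       ≤⟨ ^-mono (m + n) (∙-∨-least (x≤x∨y _ _) (y≤x∨y _ _)) ⟩
          (h ∙ x ∨ h ∙ y) ^ (m + n)     ≤⟨ [x∨y]^[m+n]≤x^m∨y^n _ _ m n ⟩
          (h ∙ x) ^ m ∨ (h ∙ y) ^ n     ≤⟨ ∨-least
                                             (≤-trans (^-mono m (∙-mono (x∙y≤x f g) ≤-refl)) le)
                                             (≤-trans (^-mono n (∙-mono (x∙y≤y f g) ≤-refl)) le′) ⟩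
          z                             ∎)
        (^-closed (m + n) (∙-closed (∙-closed f∈F g∈F) x∨y∈F))
      where
      open PosetReasoning poset
      h = f ∙ g

  -- Residual primeness versus join primeness.

  ⇨Prime⊆∨Prime : ∀ p → ⇨PrimeFilters A p ⊆ ∨PrimeFilters A p
  ⇨Prime⊆∨Prime p (isFilter , prime) = isFilter , λ x y x∨y∈F →
    [ (λ x⇨y∈F → inj₂ (upwardClosed (∙-∨-least (⇨-eval x y) (x∙y≤y _ _)) (∙-closed x⇨y∈F x∨y∈F)))
    , (λ y⇨x∈F → inj₁ (upwardClosed (∙-∨-least (x∙y≤y _ _) (⇨-eval y x)) (∙-closed y⇨x∈F x∨y∈F)))
    ] (prime x y)
    where open IsFilter isFilter

  ⇝Prime⊆∨Prime : ∀ p → ⇝PrimeFilters A p ⊆ ∨PrimeFilters A p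
  ⇝Prime⊆∨Prime p (isFilter , prime) = isFilter , λ x y x∨y∈F →
    -- `x ⇝ y` evaluates from the right, so joins are distributed in the left factor.
    [ (λ x⇝y∈F → inj₂ (upwardClosed (∨-∙-least (⇝-eval x y) (x∙y≤x _ _)) (∙-closed x∨y∈F x⇝y∈F)))
    , (λ y⇝x∈F → inj₁ (upwardClosed (∨-∙-least (x∙y≤x _ _) (⇝-eval y x)) (∙-closed x∨y∈F y⇝x∈F)))
    ] (prime x y)
    where open IsFilter isFilter

  ⇨MTL⇒∨Prime⊆⇨Prime : Is⇨MTL A → ∀ p → ∨PrimeFilters A p ⊆ ⇨PrimeFilters A p
  ⇨MTL⇒∨Prime⊆⇨Prime mtl p (isFilter , prime) =
    isFilter , λ x y → prime _ _ (≈1⇒∈ isFilter (mtl x y))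

  ⇝MTL⇒∨Prime⊆⇝Prime : Is⇝MTL A → ∀ p → ∨PrimeFilters A p ⊆ ⇝PrimeFilters A p
  ⇝MTL⇒∨Prime⊆⇝Prime mtl p (isFilter , prime) =
    isFilter , λ x y → prime _ _ (≈1⇒∈ isFilter (mtl x y))

  -- Separating elements from `1#` by ∨-prime filters.

  module Separation (em : ∀ {ℓ} → ExcludedMiddle ℓ)
                    (zorn : ∀ {a b d e} → ZornsLemma a b d e) (p : Level) where
    open Resizing em

    Resize-isFilter : ∀ {q} {F : Pred Carrier q} → IsFilter A F → IsFilter A (Resize p ∘ F)
    Resize-isFilter isFilter = record
      { nonempty     = map₂ resize nonempty
      ; upwardClosed = λ x≤y → resize ∘ upwardClosed x≤y ∘ unresize
      ; ∙-closed     = λ x∈F y∈F → resize (∙-closed (unresize x∈F) (unresize y∈F))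
      }
      where open IsFilter isFilter

    FilterAvoiding : Carrier → Set (c ⊔ ℓ₂ ⊔ lsuc p)
    FilterAvoiding a = Σ (Pred Carrier p) λ F → IsFilter A F × a ∉ F

    filtersAvoiding : Carrier → Poset (c ⊔ ℓ₂ ⊔ lsuc p) (c ⊔ p) (c ⊔ p)
    filtersAvoiding a = record
      { Carrier = FilterAvoiding a
      ; _≈_     = λ F G → proj₁ F ≐ proj₁ G
      ; _≤_     = λ F G → proj₁ F ⊆ proj₁ G
      ; isPartialOrder = record
        { isPreorder = record
          { isEquivalence = record
            { refl  = id , id
            ; sym   = λ (f , g) → g , f
            ; trans = λ (f , g) (h , k) → h ∘ f , g ∘ k
            }
          ; reflexive = proj₁
          ; trans     = λ f g → g ∘ f
          }
        ; antisym = _,_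
        }
      }

    -- Adding the principal filter of 1 covers the empty chain.
    ⋃ : ∀ {a e} → Pred (FilterAvoiding a) e → Pred Carrier (c ⊔ ℓ₂ ⊔ lsuc p ⊔ e)
    ⋃ C x = 1# ≤ x ⊎ ∃ λ F → F ∈ C × x ∈ proj₁ F

    -- Factors from two members of the chain both lie in the larger one. A factor above `1#` lies in
    -- every filter, which settles the mixed products.
    ⋃-isFilter : ∀ {a e} (C : Pred (FilterAvoiding a) e) →
      (∀ {F G} → F ∈ C → G ∈ C → proj₁ F ⊆ proj₁ G ⊎ proj₁ G ⊆ proj₁ F) →
      IsFilter A (⋃ C)
    ⋃-isFilter C chain = record
      { nonempty     = 1# , inj₁ ≤-refl
      ; upwardClosed = λ where
          x≤y (inj₁ 1≤x) → inj₁ (≤-trans 1≤x x≤y)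
          x≤y (inj₂ (F , F∈C , x∈F)) →
            inj₂ (F , F∈C , IsFilter.upwardClosed (proj₁ (proj₂ F)) x≤y x∈F)
      ; ∙-closed     = ∙-closed
      }
      where
      ≥1⇒∈ : ∀ F {x} → 1# ≤ x → x ∈ proj₁ F
      ≥1⇒∈ (_ , isFilter , _) 1≤x = IsFilter.upwardClosed isFilter 1≤x (1∈ isFilter)

      product : ∀ F {x y} → F ∈ C → x ∈ proj₁ F → y ∈ proj₁ F → x ∙ y ∈ ⋃ C
      product F@(_ , isFilter , _) F∈C x∈F y∈F =
        inj₂ (F , F∈C , IsFilter.∙-closed isFilter x∈F y∈F)

      ∙-closed : ∀ {x y} → x ∈ ⋃ C → y ∈ ⋃ C → x ∙ y ∈ ⋃ C
      ∙-closed (inj₁ 1≤x) (inj₁ 1≤y) =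
        inj₁ (≤-trans (≤-reflexive (Eq.sym (proj₁ identity 1#))) (∙-mono 1≤x 1≤y))
      ∙-closed (inj₁ 1≤x) (inj₂ (G , G∈C , y∈G)) = product G G∈C (≥1⇒∈ G 1≤x) y∈G
      ∙-closed (inj₂ (F , F∈C , x∈F)) (inj₁ 1≤y) = product F F∈C x∈F (≥1⇒∈ F 1≤y)
      ∙-closed (inj₂ (F , F∈C , x∈F)) (inj₂ (G , G∈C , y∈G)) =
        [ (λ F⊆G → product G G∈C (F⊆G x∈F) y∈G)
        , (λ G⊆F → product F F∈C x∈F (G⊆F y∈G))
        ] (chain F∈C G∈C)

    maximal⇒∨Prime : ∀ {a} (F : FilterAvoiding a) →
      (∀ (G : FilterAvoiding a) → proj₁ F ⊆ proj₁ G → proj₁ G ⊆ proj₁ F) →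
      proj₁ F ∈ ∨PrimeFilters A p
    maximal⇒∨Prime {a} (F , isFilter , a∉F) maximal = isFilter , prime
      where
      -- If the filter generated by `F` and `x` still avoids `a`, its resized copy competes with
      -- `F`, and maximality puts `x` into `F`.
      absorb : ∀ x → a ∉ Adjoin isFilter x → x ∈ F
      absorb x a∉ = maximal
        (Resize p ∘ Adjoin isFilter x , Resize-isFilter (Adjoin-isFilter isFilter x) , a∉ ∘ unresize)
        (resize ∘ ⊆Adjoin isFilter x)
        (resize (∈Adjoin isFilter x))

      prime : ∀ x y → x ∨ y ∈ F → x ∈ F ⊎ y ∈ F
      prime x y x∨y∈F with em {P = a ∈ Adjoin isFilter x} | em {P = a ∈ Adjoin isFilter y}
      ... | no a∉  | _      = inj₁ (absorb x a∉)
      ... | yes _  | no a∉  = inj₂ (absorb y a∉)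
      ... | yes a∈ | yes a∈′ = contradiction (Adjoin-∨ isFilter x∨y∈F a∈ a∈′) a∉F

    ∃∨PrimeAvoiding : ∀ {a} → ¬ a ≈ 1# → ∃ λ F → F ∈ ∨PrimeFilters A p × a ∉ F
    ∃∨PrimeAvoiding {a} a≉1 =
      let F , maximal = zorn {e = 0ℓ} (filtersAvoiding a) upperBound
      -- Maximality yields an equality of filters, whose first half is the inclusion of `G` in `F`.
      in  proj₁ F , maximal⇒∨Prime F (λ G F⊆G → proj₁ (maximal {G} F⊆G)) , proj₂ (proj₂ F)
      where
      open Poset (filtersAvoiding a) using () renaming (_≤_ to _⊑_)

      upperBound : ∀ (C : Pred (FilterAvoiding a) 0ℓ) →
        (∀ {F G} → F ∈ C → G ∈ C → F ⊑ G ⊎ G ⊑ F) → ∃ λ U → ∀ {F} → F ∈ C → F ⊑ U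
      upperBound C chain =
        (Resize p ∘ ⋃ C , Resize-isFilter (⋃-isFilter C chain) , a∉⋃ ∘ unresize) ,
        λ {F} F∈C x∈F → resize (inj₂ (F , F∈C , x∈F))
        where
        a∉⋃ : a ∉ ⋃ C
        -- Here `a ≉ 1` enters: the principal filter of `1#` avoids `a`, so even the empty chain has
        -- a bound.
        a∉⋃ (inj₁ 1≤a)                     = a≉1 (antisym (maximum a) 1≤a)
        a∉⋃ (inj₂ ((_ , _ , a∉F) , _ , a∈F)) = a∉F a∈F

    -- The contrapositive of separation: it reduces each prelinearity law to membership in all
    -- ∨-prime filters, where one disjunct suffices.
    ∈∨Primes⇒≈1 : ∀ {a} → (∀ {F} → F ∈ ∨PrimeFilters A p → a ∈ F) → a ≈ 1#
    ∈∨Primes⇒≈1 a∈ = decidable-stable em λ a≉1 →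
      let _ , prime , a∉F = ∃∨PrimeAvoiding a≉1 in a∉F (a∈ prime)

    ∨Prime⊆⇨Prime⇒⇨MTL : ∨PrimeFilters A p ⊆ ⇨PrimeFilters A p → Is⇨MTL A
    ∨Prime⊆⇨Prime⇒⇨MTL ∨⊆⇨ x y = ∈∨Primes⇒≈1 λ prime →
      let isFilter , total = ∨⊆⇨ prime in ∨-closed isFilter (total x y)

    ∨Prime⊆⇝Prime⇒⇝MTL : ∨PrimeFilters A p ⊆ ⇝PrimeFilters A p → Is⇝MTL A
    ∨Prime⊆⇝Prime⇒⇝MTL ∨⊆⇝ x y = ∈∨Primes⇒≈1 λ prime →
      let isFilter , total = ∨⊆⇝ prime in ∨-closed isFilter (total x y)

    -- The three equivalences.

    ⇨MTL⇔⇨Prime≐∨Prime : Is⇨MTL A ⇔ (⇨PrimeFilters A p ≐ ∨PrimeFilters A p)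
    ⇨MTL⇔⇨Prime≐∨Prime = mk⇔ to from
      where
      to : Is⇨MTL A → ⇨PrimeFilters A p ≐ ∨PrimeFilters A p
      to mtl = ⇨Prime⊆∨Prime p , ⇨MTL⇒∨Prime⊆⇨Prime mtl p

      from : ⇨PrimeFilters A p ≐ ∨PrimeFilters A p → Is⇨MTL A
      from (_ , ∨⊆⇨) = ∨Prime⊆⇨Prime⇒⇨MTL ∨⊆⇨

    ⇝MTL⇔⇝Prime≐∨Prime : Is⇝MTL A ⇔ (⇝PrimeFilters A p ≐ ∨PrimeFilters A p)
    ⇝MTL⇔⇝Prime≐∨Prime = mk⇔ to from
      where
      to : Is⇝MTL A → ⇝PrimeFilters A p ≐ ∨PrimeFilters A p
      to mtl = ⇝Prime⊆∨Prime p , ⇝MTL⇒∨Prime⊆⇝Prime mtl p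

      from : ⇝PrimeFilters A p ≐ ∨PrimeFilters A p → Is⇝MTL A
      from (_ , ∨⊆⇝) = ∨Prime⊆⇝Prime⇒⇝MTL ∨⊆⇝

    pseudoMTL⇔Prime≐∨Prime : IsPseudoMTL A ⇔ (PrimeFilters A p ≐ ∨PrimeFilters A p)
    pseudoMTL⇔Prime≐∨Prime = mk⇔ to from
      where
      to : IsPseudoMTL A → PrimeFilters A p ≐ ∨PrimeFilters A p
      to (⇨mtl , ⇝mtl) =
        (λ (⇨prime , _) → ⇨Prime⊆∨Prime p ⇨prime) ,
        (λ prime → ⇨MTL⇒∨Prime⊆⇨Prime ⇨mtl p prime , ⇝MTL⇒∨Prime⊆⇝Prime ⇝mtl p prime)

      from : PrimeFilters A p ≐ ∨PrimeFilters A p → IsPseudoMTL A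
      from (_ , ∨⊆prime) =
        ∨Prime⊆⇨Prime⇒⇨MTL (proj₁ ∘ ∨⊆prime) , ∨Prime⊆⇝Prime⇒⇝MTL (proj₂ ∘ ∨⊆prime)

theorem5p7 : (∀ {ℓ} → ExcludedMiddle ℓ) →
    (∀ {a b d e} → ZornsLemma a b d e) →
    ∀ {c ℓ₁ ℓ₂} (A : IntegralResiduatedJoinSemilattice c ℓ₁ ℓ₂) (p : Level) →
    (Is⇨MTL A ⇔ (⇨PrimeFilters A p ≐ ∨PrimeFilters A p)) ×
    (Is⇝MTL A ⇔ (⇝PrimeFilters A p ≐ ∨PrimeFilters A p)) ×
    (IsPseudoMTL A ⇔ (PrimeFilters A p ≐ ∨PrimeFilters A p))
theorem5p7 em zorn A p = ⇨MTL⇔⇨Prime≐∨Prime , ⇝MTL⇔⇝Prime≐∨Prime , pseudoMTL⇔Prime≐∨Prime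
  where
  open Properties A
  open Separation em zorn p
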